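{- Let $\ell \geq 4$ be an even integer. For every integer $n > 12\ell^2 + 36\ell + 24$, there exists a regular graph on $n$ vertices that is $C_{\ell+1}$-saturated.
   Context: $C_{\ell+1}$ denotes the cycle on $\ell+1$ vertices. A graph $G$ is $F$-free if it contains no subgraph isomorphic to $F$; $G$ is $F$-saturated if $G$ is $F$-free and adding any edge between two non-adjacent vertices of $G$ creates a subgraph isomorphic to $F$. A graph is regular if all its vertices have the same degree. -}

module Defs where

open import Data.Bool using (Bool; true; false; _∨_; _∧_; if_then_else_)
open import Data.Nat using (ℕ; zero; suc; _+_)
open import Data.Fin using (Fin; zero; suc; inject₁; fromℕ)
open import Data.Fin.Properties using (_≟_)
open import Data.List using (List; map; allFin)
open import Data.Nat.ListAction using (sum)
open import Data.Empty using (⊥)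
open import Data.Product using (Σ; _×_; ∃)
open import Relation.Binary.PropositionalEquality using (_≡_; _≢_)
open import Relation.Nullary using (¬_)
open import Relation.Nullary.Decidable using (⌊_⌋)
open import Function.Definitions using (Injective)

record Graph (n : ℕ) : Set where
  field
    adj    : Fin n → Fin n → Bool
    symm   : ∀ i j → adj i j ≡ adj j i
    irrefl : ∀ i → adj i i ≡ false
open Graph public

degree : ∀ {n} → Graph n → Fin n → ℕ
degree {n} G v = sum (map (λ w → if adj G v w then 1 else 0) (allFin n))

Regular : ∀ {n} → Graph n → Set
Regular {n} G = ∃ λ d → ∀ v → degree G v ≡ d

-- The relation E (on Fin n) contains a cycle on suc m vertices as a subgraph:
-- distinct vertices f 0, …, f m with f i ~ f (i+1) for i < m and f m ~ f 0.
-- (Only used with suc m ≥ 3, where this is the cycle C_{suc m}.)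
HasCycle : ∀ {n} → ℕ → (Fin n → Fin n → Bool) → Set
HasCycle {n} zero    E = ⊥
HasCycle {n} (suc m) E =
  Σ (Fin (suc m) → Fin n) λ f →
    Injective _≡_ _≡_ f
    × (∀ (i : Fin m) → E (f (inject₁ i)) (f (suc i)) ≡ true)
    × E (f (fromℕ m)) (f zero) ≡ true

addEdge : ∀ {n} → Graph n → Fin n → Fin n → (Fin n → Fin n → Bool)
addEdge G a b x y =
  adj G x y ∨ ((⌊ x ≟ a ⌋ ∧ ⌊ y ≟ b ⌋) ∨ (⌊ x ≟ b ⌋ ∧ ⌊ y ≟ a ⌋))

Saturated : ∀ {n} → ℕ → Graph n → Set
Saturated k G =
  ¬ HasCycle k (adj G)
  × (∀ a b → a ≢ b → adj G a b ≡ false → HasCycle k (addEdge G a b))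

{-# OPTIONS --safe #-}

-- For even n the complete bipartite graph K_{n/2,n/2} works. For odd n take a circulant graph on ℤ/n. Since n is odd,
-- every nonzero residue is ± an odd number below n, and a suitable set of odd distances is {1, 3, …, M} without the
-- numbers M − 2e, e ≤ h odd, where n = (ℓ + 1)M − 2h with h odd. Any ℓ + 1 signed distances have an odd sum of absolute
-- value at most (ℓ + 1)M = n + 2h, and the removed distances are exactly what keeps this sum from being ±n, so there is
-- not even a closed walk of length ℓ + 1. Conversely two non-adjacent vertices differ by ±t for an even t
-- such that n − t is not an admissible distance. If t ≥ ℓ, then t is a sum of ℓ admissible distances, and the partial
-- sums form a path; if t < ℓ, the new edge lies on the cycle 0, t, t + 1, …, t + ℓ − 1.
module Submission where

open import Defs
open import Data.Bool using (Bool; true; false; if_then_else_; _∨_; _∧_)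
open import Data.Bool.Properties using (∨-zeroʳ)
open import Data.Nat using (ℕ; zero; suc; _+_; _*_; _∸_; _≤_; _<_; z≤n; s≤s; NonZero; ∣_-_∣; _≤?_; _<?_)
open import Data.Nat.Properties
open import Data.Nat.DivMod
open import Data.Nat.Divisibility
open import Data.Nat.ListAction using (sum)
open import Data.Nat.ListAction.Properties using (sum-++)
open import Data.Nat.Tactic.RingSolver using (solve-∀)
open import Data.Fin using (Fin; zero; suc; toℕ; inject₁; fromℕ)
open import Data.Fin.Properties using (toℕ<n; toℕ-inject₁; toℕ-fromℕ; toℕ-fromℕ<; toℕ-injective)
import Data.Fin.Properties as Fin
open import Data.Fin.Induction using (<-weakInduction)
open import Data.List using (tabulate; applyUpTo; []; _∷_; _∷ʳ_)
open import Data.List.Properties using (map-tabulate; applyUpTo-∷ʳ)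
open import Data.Product using (Σ; ∃; ∃₂; _×_; _,_; proj₁; proj₂)
open import Data.Sum using (_⊎_; inj₁; inj₂; [_,_]′)
open import Relation.Nullary using (¬_; Dec; yes; no; does; contradiction)
open import Relation.Nullary.Decidable using (dec-true; dec-false; isYes≗does; _×-dec_; _⊎-dec_; ⌊_⌋)
open import Relation.Binary.PropositionalEquality
open import Relation.Binary.Definitions using (tri<; tri≈; tri>)
open import Function using (_∘_; id)

-- Arithmetic: linear inequalities, parity, residues

slack : ∀ {a b} → a ≤ b → ∃ λ d → b ≡ a + d
slack {a} {b} a≤b = b ∸ a , sym (m+[n∸m]≡n a≤b)

-- Linear arithmetic by certificate: u ≤ v follows from a ≤ b once v − u = (b − a) + s.
linear : ∀ {a b} u v s → a ≤ b → u + b + s ≡ v + a → u ≤ v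
linear {a} {b} u v s a≤b eq = +-cancelʳ-≤ b u v (begin
  u + b      ≤⟨ m≤m+n (u + b) s ⟩
  u + b + s  ≡⟨ eq ⟩
  v + a      ≤⟨ +-monoʳ-≤ v a≤b ⟩
  v + b      ∎)
  where open ≤-Reasoning

halve : ∀ k → (∃ λ c → k ≡ 2 * c) ⊎ (∃ λ c → k ≡ 1 + 2 * c)
halve zero = inj₁ (0 , refl)
halve (suc k) with halve k
... | inj₁ (c , refl) = inj₂ (c , refl)
... | inj₂ (c , refl) = inj₁ (suc c , sym (*-suc 2 c))

odd-halve : ∀ {k} → ¬ 2 ∣ k → ∃ λ c → k ≡ 1 + 2 * c
odd-halve {k} 2∤k with halve k
... | inj₁ (c , eq) = contradiction (divides c (trans eq (*-comm 2 c))) 2∤k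
... | inj₂ p = p

2∤1+2* : ∀ c → ¬ 2 ∣ 1 + 2 * c
2∤1+2* c (divides q eq) = even≢odd q c (trans (*-comm 2 q) (sym eq))

2∤-sum : ∀ {a b} → ¬ 2 ∣ a → ¬ 2 ∣ b → 2 ∣ a + b
2∤-sum 2∤a 2∤b with odd-halve 2∤a | odd-halve 2∤b
... | c , refl | d , refl = divides (1 + c + d) (eq c d)
  where
  eq : ∀ c d → 1 + 2 * c + (1 + 2 * d) ≡ (1 + c + d) * 2
  eq = solve-∀

multiple<⇒0 : ∀ {n a} → n ∣ a → a < n → a ≡ 0
multiple<⇒0 {a = zero} _ _ = refl
multiple<⇒0 {a = suc _} n∣a a<n = contradiction a<n (≤⇒≯ (∣⇒≤ n∣a))

-- Equal residues make the difference of `u` and `v` a multiple of `n`, and it is smaller than `n`,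
-- hence zero.
%-cancelˡ-+ : ∀ n .{{_ : NonZero n}} b {u v} → u < n → v < n → (b + u) % n ≡ (b + v) % n → u ≡ v
%-cancelˡ-+ n b {u} {v} u<n v<n eq = [ (λ u≤v → ordered u≤v v<n eq) , (λ v≤u → sym (ordered v≤u u<n (sym eq))) ]′ (≤-total u v)
  where
  open ≡-Reasoning
  ordered : ∀ {u v} → u ≤ v → v < n → (b + u) % n ≡ (b + v) % n → u ≡ v
  ordered {u} u≤v v<n eq with slack u≤v
  ... | d , refl = sym (trans (cong (u +_) d≡0) (+-identityʳ u))
    where
    q q′ : ℕ
    q = (b + u) / n
    q′ = (b + (u + d)) / n
    split : q * n + d ≡ q′ * n
    split = +-cancelˡ-≡ ((b + u) % n) _ _ (begin
      (b + u) % n + (q * n + d)    ≡⟨ +-assoc ((b + u) % n) (q * n) d ⟨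
      (b + u) % n + q * n + d      ≡⟨ cong (_+ d) (m≡m%n+[m/n]*n (b + u) n) ⟨
      b + u + d                    ≡⟨ +-assoc b u d ⟩
      b + (u + d)                  ≡⟨ m≡m%n+[m/n]*n (b + (u + d)) n ⟩
      (b + (u + d)) % n + q′ * n   ≡⟨ cong (_+ q′ * n) eq ⟨
      (b + u) % n + q′ * n         ∎)
    d≡0 : d ≡ 0
    d≡0 = multiple<⇒0 (∣m+n∣m⇒∣n (subst (n ∣_) (sym split) (n∣m*n q′)) (n∣m*n q)) (≤-<-trans (m≤n+m d u) v<n)

-- Sums over distances, for the degrees

sum-tabulate : ∀ n (g : ℕ → ℕ) → sum (tabulate {n = n} (g ∘ toℕ)) ≡ sum (applyUpTo g n)
sum-tabulate zero g = refl
sum-tabulate (suc n) g = cong (g 0 +_) (sum-tabulate n (g ∘ suc))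

sum-last : ∀ (g : ℕ → ℕ) n → sum (applyUpTo g (suc n)) ≡ g n + sum (applyUpTo g n)
sum-last g n = begin
  sum (applyUpTo g (suc n))        ≡⟨ cong sum (applyUpTo-∷ʳ g n) ⟨
  sum (applyUpTo g n ∷ʳ g n)       ≡⟨ sum-++ (applyUpTo g n) (g n ∷ []) ⟩
  sum (applyUpTo g n) + (g n + 0)  ≡⟨ cong (sum (applyUpTo g n) +_) (+-identityʳ (g n)) ⟩
  sum (applyUpTo g n) + g n        ≡⟨ +-comm (sum (applyUpTo g n)) (g n) ⟩
  g n + sum (applyUpTo g n)        ∎
  where open ≡-Reasoning

-- If g is symmetric under j ↦ n − j, replacing v by v + 1 only exchanges the equal terms g (n − 1 − v) and g (v + 1).
sum-distances : ∀ {n} (g : ℕ → ℕ) → (∀ a b → a + b ≡ n → g a ≡ g b) →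
  ∀ v → v < n → sum (applyUpTo (λ w → g ∣ v - w ∣) n) ≡ sum (applyUpTo g n)
sum-distances g g-sym zero v<n = refl
sum-distances {suc n} g g-sym (suc v) (s≤s v<n) = begin
  g (suc v) + sum (applyUpTo (λ w → g ∣ v - w ∣) n)      ≡⟨ cong (_+ sum (applyUpTo (λ w → g ∣ v - w ∣) n)) (g-sym _ _ (cong suc (trans (cong (v +_) (m≤n⇒∣m-n∣≡n∸m (<⇒≤ v<n))) (m+[n∸m]≡n (<⇒≤ v<n))))) ⟩
  g ∣ v - n ∣ + sum (applyUpTo (λ w → g ∣ v - w ∣) n)    ≡⟨ sum-last (λ w → g ∣ v - w ∣) n ⟨
  sum (applyUpTo (λ w → g ∣ v - w ∣) (suc n))           ≡⟨ sum-distances g g-sym v (<-trans v<n (n<1+n n)) ⟩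
  sum (applyUpTo g (suc n))                              ∎
  where open ≡-Reasoning

-- Cycles from rising offsets and invariants along closed walks

vertex : ∀ n .{{_ : NonZero n}} → ℕ → Fin n
vertex n u = u mod n

toℕ-vertex : ∀ n .{{_ : NonZero n}} u → toℕ (vertex n u) ≡ u % n
toℕ-vertex n u = toℕ-fromℕ< (m%n<n u n)

vertex-≡ : ∀ n .{{_ : NonZero n}} {u} (a : Fin n) → u % n ≡ toℕ a → vertex n u ≡ a
vertex-≡ n {u} a eq = toℕ-injective (trans (toℕ-vertex n u) eq)

rising-mono : ∀ (P : ℕ → ℕ) ℓ → (∀ j → j < ℓ → P j < P (suc j)) → ∀ {i j} → i < j → j ≤ ℓ → P i < P j
rising-mono P ℓ rise {i} {suc j} (s≤s i≤j) j<ℓ with m≤n⇒m<n∨m≡n i≤j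
... | inj₁ i<j = <-trans (rising-mono P ℓ rise i<j (<⇒≤ j<ℓ)) (rise j j<ℓ)
... | inj₂ refl = rise j j<ℓ

-- Strictly rising offsets below `n` stay distinct modulo `n`, which gives injectivity. The relation
-- `R` is arbitrary so that it can be a graph with an added edge.
rising-cycle : ∀ {n} .{{_ : NonZero n}} (R : Fin n → Fin n → Bool) x (P : ℕ → ℕ) ℓ →
  (∀ j → j < ℓ → P j < P (suc j)) → P ℓ < n →
  (∀ j → j < ℓ → R (vertex n (x + P j)) (vertex n (x + P (suc j))) ≡ true) →
  R (vertex n (x + P ℓ)) (vertex n (x + P 0)) ≡ true →
  HasCycle (suc ℓ) R
rising-cycle {n} R x P ℓ rise Pℓ<n edge close = f , f-injective , f-edge , f-close
  where
  f : Fin (suc ℓ) → Fin n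
  f i = vertex n (x + P (toℕ i))
  P<n : ∀ {j} → j ≤ ℓ → P j < n
  P<n j≤ℓ with m≤n⇒m<n∨m≡n j≤ℓ
  ... | inj₁ j<ℓ = <-trans (rising-mono P ℓ rise j<ℓ ≤-refl) Pℓ<n
  ... | inj₂ refl = Pℓ<n
  bound : (i : Fin (suc ℓ)) → toℕ i ≤ ℓ
  bound i = <⇒≤pred (toℕ<n i)
  P-injective : ∀ {i j} → i ≤ ℓ → j ≤ ℓ → P i ≡ P j → i ≡ j
  P-injective {i} {j} i≤ℓ j≤ℓ eq with <-cmp i j
  ... | tri< i<j _ _ = contradiction eq (<⇒≢ (rising-mono P ℓ rise i<j j≤ℓ))
  ... | tri≈ _ i≡j _ = i≡j
  ... | tri> _ _ j<i = contradiction (sym eq) (<⇒≢ (rising-mono P ℓ rise j<i i≤ℓ))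
  f-injective : ∀ {i j} → f i ≡ f j → i ≡ j
  f-injective {i} {j} eq = toℕ-injective (P-injective (bound i) (bound j)
    (%-cancelˡ-+ n x (P<n (bound i)) (P<n (bound j))
      (trans (sym (toℕ-vertex n _)) (trans (cong toℕ eq) (toℕ-vertex n _)))))
  f-edge : ∀ (i : Fin ℓ) → R (f (inject₁ i)) (f (suc i)) ≡ true
  f-edge i rewrite toℕ-inject₁ i = edge (toℕ i) (toℕ<n i)
  f-close : R (f (fromℕ ℓ)) (f zero) ≡ true
  f-close rewrite toℕ-fromℕ ℓ = close

-- For freeness proofs: `Q s x` is an invariant of walks of `s` steps ending at `x`, and its
-- instance on return to the starting vertex is what gets refuted.
closed-walk-induction : ∀ {n} (E : Fin n → Fin n → Bool) (Q : ℕ → Fin n → Set) →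
  (∀ s x y → E x y ≡ true → Q s x → Q (suc s) y) →
  ∀ ℓ → ((f , _) : HasCycle (suc ℓ) E) → Q 0 (f zero) → Q (suc ℓ) (f zero)
closed-walk-induction E Q step ℓ (f , _ , edge , close) start =
  step ℓ _ _ close (subst (λ s → Q s (f (fromℕ ℓ))) (toℕ-fromℕ ℓ) (along (fromℕ ℓ)))
  where
  along : ∀ i → Q (toℕ i) (f i)
  along = <-weakInduction (λ i → Q (toℕ i) (f i)) start
    (λ i q → step _ _ _ (edge i) (subst (λ s → Q s (f (inject₁ i))) (toℕ-inject₁ i) q))

-- A congruence modulo `n` with multiples of `n` on both sides, free of subtraction. The two
-- outcomes are the signs of the step from `x` to `x + d`.
gap-congruence : ∀ {n t} x d → d ≡ t ⊎ d + t ≡ n → ∃₂ λ p q →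
  x + t + p * n ≡ x + d + q * n ⊎ x + d + t + p * n ≡ x + q * n
gap-congruence x d (inj₁ refl) = 0 , 0 , inj₁ refl
gap-congruence {t = t} x d (inj₂ refl) = 0 , 1 , inj₂ (eq x d t)
  where
  eq : ∀ x d t → x + d + t + 0 ≡ x + 1 * (d + t)
  eq = solve-∀

⌊≟⌋-refl : ∀ {n} (a : Fin n) → ⌊ a Fin.≟ a ⌋ ≡ true
⌊≟⌋-refl a = trans (isYes≗does (a Fin.≟ a)) (dec-true (a Fin.≟ a) refl)

-- Circulant graphs with odd distances

-- The circulant graph on ℤ/n with connection set {±(1 + 2c) : Good c}.
module Circulant (n : ℕ) .{{_ : NonZero n}} (Good : ℕ → Set) (good? : ∀ c → Dec (Good c))
  (good-short : ∀ {c} → Good c → 1 + 2 * c < n) where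

  -- Meant for the absolute difference of two representatives in `[0, n)`, which is a distance or
  -- the complement of one. The bound `c < n` makes the existential a finite search.
  Joined : ℕ → Set
  Joined t = ∃ λ c → c < n × Good c × (t ≡ 1 + 2 * c ⊎ t + (1 + 2 * c) ≡ n)

  joined? : ∀ t → Dec (Joined t)
  joined? t = anyUpTo? (λ c → good? c ×-dec (t ≟ 1 + 2 * c ⊎-dec t + (1 + 2 * c) ≟ n)) n

  good<n : ∀ {c} → Good c → c < n
  good<n {c} g = ≤-<-trans (≤-trans (m≤m+n c (c + 0)) (n≤1+n _)) (good-short g)

  good⇒joined : ∀ {c} → Good c → Joined (1 + 2 * c)
  good⇒joined g = _ , good<n g , g , inj₁ refl

  ¬joined-0 : ¬ Joined 0
  ¬joined-0 (c , _ , g , inj₂ eq) = <⇒≢ (good-short g) eq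

  joined-complement : ∀ {s t} → s + t ≡ n → Joined s → Joined t
  joined-complement {t = t} s+t≡n (c , c<n , g , inj₁ refl) = c , c<n , g , inj₂ (trans (+-comm t _) s+t≡n)
  joined-complement {s} s+t≡n (c , c<n , g , inj₂ eq) = c , c<n , g , inj₁ (+-cancelˡ-≡ s _ _ (trans s+t≡n (sym eq)))

  graph : Graph n
  graph .adj i j = does (joined? ∣ toℕ i - toℕ j ∣)
  graph .symm i j = cong (does ∘ joined?) (∣-∣-comm (toℕ i) (toℕ j))
  graph .irrefl i = trans (cong (does ∘ joined?) (∣n-n∣≡0 (toℕ i))) (dec-false (joined? 0) ¬joined-0)

  joined-sym : ∀ s t → s + t ≡ n → does (joined? s) ≡ does (joined? t)
  joined-sym s t eq with joined? s
  ... | yes p = sym (dec-true (joined? t) (joined-complement eq p))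
  ... | no ¬p = sym (dec-false (joined? t) (¬p ∘ joined-complement (trans (+-comm t s) eq)))

  regular : Regular graph
  regular = sum (applyUpTo weight n) , λ v → begin
    degree graph v                                           ≡⟨ cong sum (map-tabulate {n = n} id (λ w → weight ∣ toℕ v - toℕ w ∣)) ⟩
    sum (tabulate {n = n} (λ w → weight ∣ toℕ v - toℕ w ∣))  ≡⟨ sum-tabulate n (λ w → weight ∣ toℕ v - w ∣) ⟩
    sum (applyUpTo (λ w → weight ∣ toℕ v - w ∣) n)           ≡⟨ sum-distances weight (λ s t eq → cong (λ b → if b then 1 else 0) (joined-sym s t eq)) (toℕ v) (toℕ<n v) ⟩
    sum (applyUpTo weight n)                                 ∎
    where
    open ≡-Reasoning
    weight : ℕ → ℕ
    weight t = if does (joined? t) then 1 else 0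

  -- If `x % n + t` stays below `n`, the representatives differ by `t`. Otherwise it wraps around
  -- once and they differ by `n − t`, which is joined by `joined-complement`.
  joined-difference : ∀ x t → t < n → Joined t → Joined ∣ x % n - (x + t) % n ∣
  joined-difference x t t<n p with x % n + t <? n
  ... | yes r+t<n = subst Joined (sym (begin
    ∣ r - (x + t) % n ∣      ≡⟨ cong (∣ r -_∣) (%-distribˡ-+ x t n) ⟩
    ∣ r - (r + t % n) % n ∣  ≡⟨ cong (λ t → ∣ r - (r + t) % n ∣) (m<n⇒m%n≡m t<n) ⟩
    ∣ r - (r + t) % n ∣      ≡⟨ cong (∣ r -_∣) (m<n⇒m%n≡m r+t<n) ⟩
    ∣ r - r + t ∣            ≡⟨ ∣m-m+n∣≡n r t ⟩
    t                        ∎)) p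
    where
    open ≡-Reasoning
    r = x % n
  ... | no r+t≮n with slack (≮⇒≥ r+t≮n)
  ...   | s , eq = joined-complement (trans (cong (t +_) (begin
    ∣ r - (x + t) % n ∣      ≡⟨ cong (∣ r -_∣) (%-distribˡ-+ x t n) ⟩
    ∣ r - (r + t % n) % n ∣  ≡⟨ cong (λ t → ∣ r - (r + t) % n ∣) (m<n⇒m%n≡m t<n) ⟩
    ∣ r - (r + t) % n ∣      ≡⟨ cong (λ t → ∣ r - t % n ∣) (trans eq (+-comm n s)) ⟩
    ∣ r - (s + n) % n ∣      ≡⟨ cong (∣ r -_∣) ([m+n]%n≡m%n s n) ⟩
    ∣ r - s % n ∣            ≡⟨ cong (∣ r -_∣) (m<n⇒m%n≡m (<-trans s<r (m%n<n x n))) ⟩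
    ∣ r - s ∣                ≡⟨ m≤n⇒∣n-m∣≡n∸m (<⇒≤ s<r) ⟩
    r ∸ s                    ∎))
    (+-cancelʳ-≡ s _ _ (trans (+-assoc t (r ∸ s) s) (trans (cong (t +_) (m∸n+n≡m (<⇒≤ s<r))) (trans (+-comm t r) eq))))) p
    where
    open ≡-Reasoning
    r = x % n
    s<r : s < r
    s<r = +-cancelˡ-< n s r (subst (_< n + r) eq (subst (_< n + r) (+-comm t r) (+-monoˡ-< r t<n)))

  adj-joined : ∀ x t → t < n → Joined t → adj graph (vertex n x) (vertex n (x + t)) ≡ true
  adj-joined x t t<n p rewrite toℕ-vertex n x | toℕ-vertex n (x + t) =
    dec-true (joined? _) (joined-difference x t t<n p)

  adj-good : ∀ x {c} → Good c → adj graph (vertex n x) (vertex n (x + (1 + 2 * c))) ≡ true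
  adj-good x g = adj-joined x _ (good-short g) (good⇒joined g)

  adj⇒congruent : ∀ x y → adj graph x y ≡ true → ∃ λ c → Good c × ∃₂ λ p q →
    toℕ x + (1 + 2 * c) + p * n ≡ toℕ y + q * n ⊎ toℕ y + (1 + 2 * c) + p * n ≡ toℕ x + q * n
  adj⇒congruent x y adjacent with joined? ∣ toℕ x - toℕ y ∣
  adj⇒congruent x y () | no _
  ... | yes (c , _ , g , dist) with ≤-total (toℕ x) (toℕ y)
  ...   | inj₁ x≤y with slack x≤y
  ...     | d , eq rewrite eq | ∣m-m+n∣≡n (toℕ x) d = c , g , gap-congruence (toℕ x) d dist
  adj⇒congruent x y adjacent | yes (c , _ , g , dist) | inj₂ y≤x with slack y≤x
  ...     | d , eq rewrite eq | ∣-∣-comm (toℕ y + d) (toℕ y) | ∣m-m+n∣≡n (toℕ y) d with gap-congruence (toℕ y) d dist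
  ...       | p , q , inj₁ e = c , g , p , q , inj₂ e
  ...       | p , q , inj₂ e = c , g , p , q , inj₁ e

  Extends : (Fin n → Fin n → Bool) → Set
  Extends R = ∀ x y → adj graph x y ≡ true → R x y ≡ true

  Linked : (Fin n → Fin n → Bool) → Fin n → Fin n → Set
  Linked R x y = R x y ≡ true × R y x ≡ true

  -- Stated for any symmetric link in any extension `R`, so that one construction, started at any
  -- `x`, serves the added edge whichever endpoint comes first.
  Completes : ℕ → ℕ → Set
  Completes ℓ t = ∀ R → Extends R → ∀ x → Linked R (vertex n x) (vertex n (x + t)) → HasCycle (suc ℓ) R

  -- A chord of length `d` read from `u` has length `n − d` when read from `v`, since going on from
  -- `v` by `n − d` returns to `u`.
  chord-positions : ∀ (u v : Fin n) d t → toℕ v ≡ toℕ u + d → t ≡ d ⊎ t + d ≡ n → ∃ λ x →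
    (vertex n x ≡ u × vertex n (x + t) ≡ v) ⊎ (vertex n x ≡ v × vertex n (x + t) ≡ u)
  chord-positions u v d t eq (inj₁ refl) =
    toℕ u , inj₁ (vertex-≡ n u (m<n⇒m%n≡m (toℕ<n u)) , vertex-≡ n v (trans (cong (_% n) (sym eq)) (m<n⇒m%n≡m (toℕ<n v))))
  chord-positions u v d t eq (inj₂ t+d≡n) =
    toℕ v , inj₂ (vertex-≡ n v (m<n⇒m%n≡m (toℕ<n v)) , vertex-≡ n u (begin
      (toℕ v + t) % n        ≡⟨ cong (λ w → (w + t) % n) eq ⟩
      (toℕ u + d + t) % n    ≡⟨ cong (_% n) (+-assoc (toℕ u) d t) ⟩
      (toℕ u + (d + t)) % n  ≡⟨ cong (λ m → (toℕ u + m) % n) (trans (+-comm d t) t+d≡n) ⟩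
      (toℕ u + n) % n        ≡⟨ [m+n]%n≡m%n (toℕ u) n ⟩
      toℕ u % n              ≡⟨ m<n⇒m%n≡m (toℕ<n u) ⟩
      toℕ u                  ∎))
    where open ≡-Reasoning

  -- By rotation only the distance of the nonadjacent pair matters, and it may be exchanged for its
  -- complement by reading the chord from the other end.
  saturating : ∀ ℓ → (∀ δ → 0 < δ → δ < n → ¬ Joined δ → ∃ λ t → (t ≡ δ ⊎ t + δ ≡ n) × Completes ℓ t) →
    ∀ a b → a ≢ b → adj graph a b ≡ false → HasCycle (suc ℓ) (addEdge graph a b)
  saturating ℓ complete a b a≢b nonadjacent =
    [ (λ a≤b → cycle a b a≤b a≢b nonadjacent (new-edge , new-edge′))
    , (λ b≤a → cycle b a b≤a (a≢b ∘ sym) (trans (symm graph b a) nonadjacent) (new-edge′ , new-edge))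
    ]′ (≤-total (toℕ a) (toℕ b))
    where
    new-edge : addEdge graph a b a b ≡ true
    new-edge rewrite ⌊≟⌋-refl a | ⌊≟⌋-refl b = ∨-zeroʳ _
    new-edge′ : addEdge graph a b b a ≡ true
    new-edge′ rewrite ⌊≟⌋-refl a | ⌊≟⌋-refl b =
      trans (cong (adj graph b a ∨_) (∨-zeroʳ (⌊ b Fin.≟ a ⌋ ∧ ⌊ a Fin.≟ b ⌋))) (∨-zeroʳ _)
    extends : Extends (addEdge graph a b)
    extends x y adjacent rewrite adjacent = refl
    cycle : ∀ u v → toℕ u ≤ toℕ v → u ≢ v → adj graph u v ≡ false → Linked (addEdge graph a b) u v →
      HasCycle (suc ℓ) (addEdge graph a b)
    cycle u v u≤v u≢v nonadjacent (uv , vu) with slack u≤v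
    ... | d , v≡u+d with complete d 0<d d<n ¬joined
      where
      0<d : 0 < d
      0<d = n≢0⇒n>0 λ d≡0 → u≢v (toℕ-injective (sym (trans v≡u+d (trans (cong (toℕ u +_) d≡0) (+-identityʳ (toℕ u))))))
      d<n : d < n
      d<n = ≤-<-trans (m≤n+m d (toℕ u)) (subst (_< n) v≡u+d (toℕ<n v))
      ¬joined : ¬ Joined d
      ¬joined p = contradiction (trans (sym nonadjacent) (dec-true (joined? _)
        (subst Joined (sym (trans (cong (∣ toℕ u -_∣) v≡u+d) (∣m-m+n∣≡n (toℕ u) d))) p))) λ ()
    ... | t , t~d , completes with chord-positions u v d t v≡u+d t~d
    ...   | x , inj₁ (refl , refl) = completes (addEdge graph a b) extends x (uv , vu)
    ...   | x , inj₂ (refl , refl) = completes (addEdge graph a b) extends x (vu , uv)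

  -- The cycle 0, t, t + 1, …, t + 1 + 2p, 0, whose last edge has odd length t + 1 + 2p.
  short-completes : Good 0 → ∀ e p → Good (1 + e + p) → Completes (2 + 2 * p) (2 + 2 * e)
  short-completes good-0 e p good-top R extends x (up , _) = rising-cycle R x P (2 + 2 * p) rise
    (subst (_< n) (sym (top e p)) (good-short good-top)) edge
    (extends _ _ (trans (symm graph (vertex n (x + P (2 + 2 * p))) (vertex n (x + 0))) (subst₂ (λ h h′ → adj graph (vertex n h) (vertex n (x + h′)) ≡ true)
      (sym (+-identityʳ x)) (sym (top e p)) (adj-good x good-top))))
    where
    P : ℕ → ℕ
    P zero = 0
    P (suc j) = 2 + 2 * e + j
    top : ∀ e p → 2 + 2 * e + (1 + 2 * p) ≡ 1 + 2 * (1 + e + p)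
    top = solve-∀
    rise : ∀ j → j < 2 + 2 * p → P j < P (suc j)
    rise zero _ = s≤s z≤n
    rise (suc j) _ = +-monoʳ-< (2 + 2 * e) (n<1+n j)
    edge : ∀ j → j < 2 + 2 * p → R (vertex n (x + P j)) (vertex n (x + P (suc j))) ≡ true
    edge zero _ = subst₂ (λ h h′ → R (vertex n h) (vertex n (x + h′)) ≡ true) (sym (+-identityʳ x)) (sym (+-identityʳ (2 + 2 * e))) up
    edge (suc j) _ = extends _ _ (subst (λ h → adj graph (vertex n (x + P (suc j))) (vertex n h) ≡ true)
      (trans (+-assoc x (2 + 2 * e + j) 1) (cong (x +_) (trans (+-assoc (2 + 2 * e) j 1) (cong (2 + 2 * e +_) (+-comm j 1)))))
      (adj-good (x + P (suc j)) good-0))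

  -- A list of `s` good codes with sum `r`. The corresponding distances `1 + 2 * c` add up to
  -- `s + 2 * r`, and `height` gives their partial sums.
  data Climb : ℕ → ℕ → Set where
    stop : Climb 0 0
    step : ∀ {c s r} → Good c → Climb s r → Climb (suc s) (c + r)

  height : ∀ {s r} → Climb s r → ℕ → ℕ
  height stop _ = 0
  height (step _ _) zero = 0
  height (step {c} _ p) (suc j) = 1 + 2 * c + height p j

  height-zero : ∀ {s r} (p : Climb s r) → height p 0 ≡ 0
  height-zero stop = refl
  height-zero (step _ _) = refl

  height-top : ∀ {s r} (p : Climb s r) → height p s ≡ s + 2 * r
  height-top stop = refl
  height-top (step {c} {s} {r} _ p) = trans (cong (1 + 2 * c +_) (height-top p)) (eq c s r)
    where
    eq : ∀ c s r → 1 + 2 * c + (s + 2 * r) ≡ suc s + 2 * (c + r)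
    eq = solve-∀

  height-step : ∀ {s r} (p : Climb s r) j → j < s → ∃ λ c → Good c × height p (suc j) ≡ height p j + (1 + 2 * c)
  height-step (step {c} g p) zero _ = c , g , trans (cong (1 + 2 * c +_) (height-zero p)) (+-identityʳ _)
  height-step (step {c} _ p) (suc j) (s≤s j<s) with height-step p j j<s
  ... | c′ , g , eq = c′ , g , trans (cong (1 + 2 * c +_) eq) (sym (+-assoc (1 + 2 * c) (height p j) (1 + 2 * c′)))

  -- The partial sums form a path of `s` graph edges from `x` to `x + (s + 2 * r)`, and the new edge
  -- leads back.
  climb-completes : ∀ {s r} → Climb s r → s + 2 * r < n → Completes s (s + 2 * r)
  climb-completes {s} {r} p top<n R extends x (_ , down) = rising-cycle R x (height p) s
    (λ j j<s → let c , _ , eq = height-step p j j<s in subst (height p j <_) (sym eq) (m<m+n (height p j) (s≤s z≤n)))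
    (subst (_< n) (sym (height-top p)) top<n)
    (λ j j<s → let c , g , eq = height-step p j j<s in extends _ _ (subst (λ h → adj graph (vertex n (x + height p j)) (vertex n h) ≡ true)
      (trans (+-assoc x (height p j) (1 + 2 * c)) (cong (x +_) (sym eq))) (adj-good (x + height p j) g)))
    (subst₂ (λ h h′ → R (vertex n (x + h)) (vertex n h′) ≡ true) (sym (height-top p))
      (sym (trans (cong (x +_) (height-zero p)) (+-identityʳ x))) down)

-- Even order: the balanced complete bipartite graph

-- Reduction modulo 2 removes the multiples of the even `n`, so an odd distance changes the parity;
-- `2 ∣ x + suc y` expresses opposite parities.
distance-parity : ∀ {n} → 2 ∣ n → ∀ {x y c} a b → x + (1 + 2 * c) + a * n ≡ y + b * n → 2 ∣ x + suc y
distance-parity {n} 2∣n {x} {y} {c} a b eq = ∣m+n∣m⇒∣n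
  (subst (2 ∣_) (sym total) (∣m∣n⇒∣m+n (m∣m*n y) (∣-trans 2∣n (n∣m*n b))))
  (∣m∣n⇒∣m+n (m∣m*n c) (∣-trans 2∣n (n∣m*n a)))
  where
  rearrange : ∀ x y c an → 2 * c + an + (x + suc y) ≡ y + (x + (1 + 2 * c) + an)
  rearrange = solve-∀
  double : ∀ y bn → y + (y + bn) ≡ 2 * y + bn
  double = solve-∀
  total : 2 * c + a * n + (x + suc y) ≡ 2 * y + b * n
  total = trans (rearrange x y c (a * n)) (trans (cong (y +_) eq) (double y (b * n)))

-- Here the circulant graph with all odd distances is the balanced complete bipartite graph.
even-order : ∀ ν p → 2 + 2 * p ≤ suc ν → Σ (Graph (2 * suc ν)) λ G → Regular G × Saturated (3 + 2 * p) G
even-order ν p ℓ≤ν = graph , regular , free , saturating (2 + 2 * p) complete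
  where
  n : ℕ
  n = 2 * suc ν
  open Circulant n (λ c → 1 + 2 * c < n) (λ c → 1 + 2 * c <? n) id

  2∣n : 2 ∣ n
  2∣n = m∣m*n (suc ν)

  flip-parity : ∀ x y → adj graph x y ≡ true → 2 ∣ toℕ x + suc (toℕ y)
  flip-parity x y adjacent with adj⇒congruent x y adjacent
  ... | c , _ , a , b , inj₁ eq = distance-parity 2∣n {c = c} a b eq
  ... | c , _ , a , b , inj₂ eq = subst (2 ∣_) (swap (toℕ y) (toℕ x)) (distance-parity 2∣n {c = c} a b eq)
    where
    swap : ∀ x y → x + suc y ≡ y + suc x
    swap = solve-∀

  free : ¬ HasCycle (3 + 2 * p) (adj graph)
  -- The invariant says that `s` steps from `w` reach a vertex of the parity of `w + s`. Back at `w`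
  -- it would make `2 * w` plus the odd cycle length even.
  free cycle = 2∤1+2* (w + 1 + p) (subst (2 ∣_) (total w p)
    (closed-walk-induction (adj graph) (λ s x → 2 ∣ w + toℕ x + s) advance (2 + 2 * p) cycle (subst (2 ∣_) (double w) (m∣m*n w))))
    where
    w : ℕ
    w = toℕ (proj₁ cycle zero)
    double : ∀ w → 2 * w ≡ w + w + 0
    double = solve-∀
    total : ∀ w p → w + w + (3 + 2 * p) ≡ 1 + 2 * (w + 1 + p)
    total = solve-∀
    advance : ∀ s x y → adj graph x y ≡ true → 2 ∣ w + toℕ x + s → 2 ∣ w + toℕ y + suc s
    advance s x y adjacent 2∣wxs = ∣m+n∣m⇒∣n
      (subst (2 ∣_) (rearrange w s (toℕ x) (toℕ y)) (∣m∣n⇒∣m+n (flip-parity x y adjacent) (m∣m*n (w + s)))) 2∣wxs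
      where
      rearrange : ∀ w s x y → x + suc y + 2 * (w + s) ≡ w + x + s + (w + y + suc s)
      rearrange = solve-∀

  complete-short : ∀ d e → suc (d + e) ≡ ν → d ≤ e → Completes (2 + 2 * p) (2 * suc d)
  -- The shorter of the two complementary distances leaves room below `n` for the unit steps that
  -- follow the new edge.
  complete-short d e refl d≤e = subst (Completes (2 + 2 * p)) (sym (*-suc 2 d))
    (short-completes (*-monoʳ-≤ 2 {1} {suc (suc (d + e))} (s≤s z≤n)) d p (linear _ n 0 (+-mono-≤ d≤e ℓ≤ν) (top d e p)))
    where
    top : ∀ d e p → suc (1 + 2 * (1 + d + p)) + (e + suc (suc (d + e))) + 0 ≡ 2 * suc (suc (d + e)) + (d + (2 + 2 * p))
    top = solve-∀

  complete : ∀ δ → 0 < δ → δ < n → ¬ Joined δ → ∃ λ t → (t ≡ δ ⊎ t + δ ≡ n) × Completes (2 + 2 * p) t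
  complete δ 0<δ δ<n ¬joined with halve δ
  -- Every odd number below `n` is a distance here, so only even `δ` remain.
  ... | inj₂ (c , refl) = contradiction (good⇒joined {c} δ<n) ¬joined
  ... | inj₁ (suc d , refl) with slack (*-cancelˡ-< 2 (suc d) (suc ν) δ<n)
  ...   | e , refl with ≤-total d e
  ...     | inj₁ d≤e = _ , inj₁ refl , complete-short d e refl d≤e
  ...     | inj₂ e≤d = 2 * suc e , inj₂ (total d e) , complete-short e d (cong suc (+-comm e d)) e≤d
    where
    total : ∀ d e → 2 * suc e + 2 * suc d ≡ 2 * suc (suc (d + e))
    total = solve-∀

-- Odd order: arithmetic of code sums

closing-sum : ∀ w n h a b {U} → w + 2 * U + a * n ≡ w + (n + 2 * h) + b * n → 2 * U + a * n ≡ 2 * h + (1 + b) * n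
closing-sum w n h a b {U} eq = +-cancelˡ-≡ w _ _ (trans (sym (+-assoc w (2 * U) (a * n))) (trans eq (rearrange w n h b)))
  where
  rearrange : ∀ w n h b → w + (n + 2 * h) + b * n ≡ w + (2 * h + (1 + b) * n)
  rearrange = solve-∀

-- Reversing a closed walk exchanges `U` and `V`: as `2 * (U + V)` is congruent to `4 * h` modulo
-- `n`, the congruence of `2 * U` with `2 * h` passes to `V`.
complementary-sum : ∀ n h a b {U V} → U + V ≡ n + 2 * h → 2 * U + a * n ≡ 2 * h + (1 + b) * n →
  2 * V + (1 + b) * n ≡ 2 * h + (2 + a) * n
complementary-sum n h a b {U} {V} sum≡ eq = +-cancelˡ-≡ (2 * U + a * n) _ _ (begin
  2 * U + a * n + (2 * V + (1 + b) * n)          ≡⟨ collect n a b U V ⟩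
  2 * (U + V) + (a + (1 + b)) * n                ≡⟨ cong (λ t → 2 * t + (a + (1 + b)) * n) sum≡ ⟩
  2 * (n + 2 * h) + (a + (1 + b)) * n            ≡⟨ expand n h a b ⟩
  2 * h + (1 + b) * n + (2 * h + (2 + a) * n)    ≡⟨ cong (_+ (2 * h + (2 + a) * n)) eq ⟨
  2 * U + a * n + (2 * h + (2 + a) * n)          ∎)
  where
  open ≡-Reasoning
  collect : ∀ n a b U V → 2 * U + a * n + (2 * V + (1 + b) * n) ≡ 2 * (U + V) + (a + (1 + b)) * n
  collect = solve-∀
  expand : ∀ n h a b → 2 * (n + 2 * h) + (a + (1 + b)) * n ≡ 2 * h + (1 + b) * n + (2 * h + (2 + a) * n)
  expand = solve-∀

-- For the case that `n − t = 1 + 2 * c` exceeds the largest distance. Here `l = m − h − 1` is the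
-- largest code whose defect `m − l` exceeds `h`.
low-bound : ∀ p {m r c h l} → m ≡ suc h + l → (3 + 2 * p) * m ≡ r + c + h → m < c → r ≤ (1 + 2 * p) * m + l
low-bound p {m} {r} {c} {h} {l} refl eq m<c = linear r _ 0 m<c
  (+-cancelʳ-≡ h _ _ (trans (left r c h) (trans (sym eq) (right p h l))))
  where
  left : ∀ r c h → r + c + 0 + h ≡ r + c + h
  left = solve-∀
  right : ∀ p h l → (3 + 2 * p) * (suc h + l) ≡ (1 + 2 * p) * (suc h + l) + l + suc (suc h + l) + h
  right = solve-∀

-- For the case of a removed distance, with defect `e = m − c` at most `h`: the target is then
-- exactly `1 + 2 * p` codes `m` and one code `g = m − (h − e)`.
high-sum : ∀ p {m r c e w g h} → m ≡ c + e → h ≡ e + w → m ≡ w + g → (3 + 2 * p) * m ≡ r + c + h →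
  (1 + 2 * p) * m + g ≡ r
high-sum p {m} {r} {c} {e} {w} {g} {h} m≡c+e h≡e+w m≡w+g eq = +-cancelʳ-≡ (m + w) _ _ (begin
  (1 + 2 * p) * m + g + (m + w)    ≡⟨ collect p m g w ⟩
  (2 + 2 * p) * m + (w + g)        ≡⟨ cong ((2 + 2 * p) * m +_) m≡w+g ⟨
  (2 + 2 * p) * m + m              ≡⟨ +-comm ((2 + 2 * p) * m) m ⟩
  (3 + 2 * p) * m                  ≡⟨ eq ⟩
  r + c + h                        ≡⟨ cong (r + c +_) h≡e+w ⟩
  r + c + (e + w)                  ≡⟨ assoc r c e w ⟩
  r + (c + e + w)                  ≡⟨ cong (λ m → r + (m + w)) m≡c+e ⟨
  r + (m + w)                      ∎)
  where
  open ≡-Reasoning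
  collect : ∀ p m g w → (1 + 2 * p) * m + g + (m + w) ≡ (2 + 2 * p) * m + (w + g)
  collect = solve-∀
  assoc : ∀ r c e w → r + c + (e + w) ≡ r + (c + e + w)
  assoc = solve-∀

-- The equation `order`, rewritten for an even distance `t = (2 + 2 * p) + 2 * r` with complement
-- `1 + 2 * c`.
half-order : ∀ p {ν m r c h} → ν ≡ suc (p + r) + c → 1 + 2 * ν + 2 * h ≡ (3 + 2 * p) * (1 + 2 * m) →
  (3 + 2 * p) * m ≡ r + c + h
half-order p {m = m} {r} {c} {h} refl order = *-cancelˡ-≡ _ _ 2 (+-cancelˡ-≡ (3 + 2 * p) _ _
  (trans (left p m) (trans (sym order) (right p r c h))))
  where
  left : ∀ p m → 3 + 2 * p + 2 * ((3 + 2 * p) * m) ≡ (3 + 2 * p) * (1 + 2 * m)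
  left = solve-∀
  right : ∀ p r c h → 1 + 2 * (suc (p + r) + c) + 2 * h ≡ 3 + 2 * p + 2 * (r + c + h)
  right = solve-∀

-- Odd order: the circulant graph with removed distances

-- Write M = 1 + 2m for the largest admissible distance; the others are M − 2e with e even or e > h.
-- Encoding a signed step D as (M − D)/2 ∈ [0, M], the codes along a closed walk of length ℓ + 1 add up to h,
-- possibly after reversing the walk; then every code is at most h, hence even, whereas h is odd.
module OddOrder (ν p m h : ℕ) (order : 1 + 2 * ν + 2 * h ≡ (3 + 2 * p) * (1 + 2 * m))
  (2∤h : ¬ 2 ∣ h) (m-large : 2 * h + 2 * p < m) where

  n : ℕ
  n = 1 + 2 * ν

  Good : ℕ → Set
  Good c = c ≤ m × (h < m ∸ c ⊎ 2 ∣ m ∸ c)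

  good? : ∀ c → Dec (Good c)
  good? c = c ≤? m ×-dec (h <? m ∸ c ⊎-dec 2 ∣? m ∸ c)

  good : ∀ {c e} → c + e ≡ m → h < e ⊎ 2 ∣ e → Good c
  good {c} {e} eq defect = subst (c ≤_) eq (m≤m+n c e) ,
    subst (λ e → h < e ⊎ 2 ∣ e) (sym (trans (cong (_∸ c) (sym eq)) (m+n∸m≡n c e))) defect

  h<m : h < m
  h<m = ≤-<-trans (≤-trans (m≤m+n h (h + 0)) (m≤m+n (2 * h) (2 * p))) m-large

  2h<m : 2 * h < m
  2h<m = ≤-<-trans (m≤m+n (2 * h) (2 * p)) m-large

  M<n : 1 + 2 * m < n
  M<n = +-cancelʳ-< (2 * h) (1 + 2 * m) n (subst (1 + 2 * m + 2 * h <_) (sym order)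
    (linear _ _ (2 + 3 * m + 2 * p * (1 + 2 * m)) 2h<m (eq m h p)))
    where
    eq : ∀ m h p → suc (1 + 2 * m + 2 * h) + m + (2 + 3 * m + 2 * p * (1 + 2 * m)) ≡ (3 + 2 * p) * (1 + 2 * m) + suc (2 * h)
    eq = solve-∀

  good-short : ∀ {c} → Good c → 1 + 2 * c < n
  good-short (c≤m , _) = ≤-<-trans (s≤s (*-monoʳ-≤ 2 c≤m)) M<n

  open Circulant n Good good? good-short public

  -- Freeness: code sums of closed walks

  -- U and V add up (M − D)/2 and (M + D)/2 over the steps D of a walk of length s from w to y.
  Sums : ℕ → ℕ → ℕ → ℕ → ℕ → Set
  Sums s w y U V = U + V ≡ s * (1 + 2 * m) × (U ≤ h → 2 ∣ U) × (V ≤ h → 2 ∣ V) ×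
    ∃₂ λ a b → y + 2 * U + a * n ≡ w + s * (1 + 2 * m) + b * n

  add-even : ∀ {A B} → (A ≤ h → 2 ∣ A) → (B ≤ h → 2 ∣ B) → A + B ≤ h → 2 ∣ A + B
  add-even {A} {B} evenA evenB A+B≤h = ∣m∣n⇒∣m+n (evenA (≤-trans (m≤m+n A B) A+B≤h)) (evenB (≤-trans (m≤n+m B A) A+B≤h))

  sums-trans : ∀ {s t w x y U V u v} → Sums s w x U V → Sums t x y u v → Sums (t + s) w y (U + u) (V + v)
  sums-trans {s} {t} {w} {x} {y} {U} {V} {u} {v} (UV , evenU , evenV , a , b , eq) (uv , evenu , evenv , a′ , b′ , eq′) =
    trans (shuffle U V u v) (trans (cong₂ _+_ uv UV) (sym (*-distribʳ-+ (1 + 2 * m) t s))) ,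
    add-even evenU evenu , add-even evenV evenv , a + a′ , b + b′ ,
    +-cancelˡ-≡ x _ _ (trans (left x y U u a a′ n) (trans (cong₂ _+_ eq eq′) (right x w s t b b′ n (1 + 2 * m))))
    where
    shuffle : ∀ U V u v → U + u + (V + v) ≡ u + v + (U + V)
    shuffle = solve-∀
    left : ∀ x y U u a a′ n → x + (y + 2 * (U + u) + (a + a′) * n) ≡ x + 2 * U + a * n + (y + 2 * u + a′ * n)
    left = solve-∀
    right : ∀ x w s t b b′ n M → w + s * M + b * n + (x + t * M + b′ * n) ≡ x + (w + (t + s) * M + (b + b′) * n)
    right = solve-∀

  -- A step `D = 1 + 2 * c` has the codes `m − c` and `1 + m + c`. The first is even or above `h` by
  -- `Good`, the second exceeds `m` and so `h`. A step in the negative direction swaps them.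
  sums-edge : ∀ x y → adj graph x y ≡ true → ∃₂ λ u v → Sums 1 (toℕ x) (toℕ y) u v
  sums-edge x y adjacent with adj⇒congruent x y adjacent
  ... | c , (c≤m , defect) , a , b , congruent = orient congruent
    where
    e : ℕ
    e = m ∸ c
    e+c : m ≡ e + c
    e+c = sym (m∸n+n≡m c≤m)
    even-e : e ≤ h → 2 ∣ e
    even-e e≤h = [ (λ h<e → contradiction e≤h (<⇒≱ h<e)) , id ]′ defect
    even-e′ : 1 + m + c ≤ h → 2 ∣ 1 + m + c
    even-e′ e′≤h = contradiction (≤-trans (≤-trans (m≤m+n (1 + m) c) e′≤h) (<⇒≤ h<m)) (<⇒≱ ≤-refl)
    total : ∀ e c m → m ≡ e + c → e + (1 + m + c) ≡ 1 * (1 + 2 * m)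
    total e c _ refl = expand e c
      where
      expand : ∀ e c → e + (1 + (e + c) + c) ≡ 1 * (1 + 2 * (e + c))
      expand = solve-∀
    up : ∀ x y m → m ≡ e + c → x + (1 + 2 * c) + a * n ≡ y + b * n → y + 2 * e + b * n ≡ x + 1 * (1 + 2 * m) + a * n
    up x y _ refl eq = trans (left y e (b * n)) (trans (cong (_+ 2 * e) (sym eq)) (right x e c (a * n)))
      where
      left : ∀ y e bn → y + 2 * e + bn ≡ y + bn + 2 * e
      left = solve-∀
      right : ∀ x e c an → x + (1 + 2 * c) + an + 2 * e ≡ x + 1 * (1 + 2 * (e + c)) + an
      right = solve-∀
    down : ∀ x y → y + (1 + 2 * c) + a * n ≡ x + b * n → y + 2 * (1 + m + c) + a * n ≡ x + 1 * (1 + 2 * m) + b * n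
    down x y eq = trans (left y m c (a * n)) (trans (cong (_+ (1 + 2 * m)) eq) (right x m (b * n)))
      where
      left : ∀ y m c an → y + 2 * (1 + m + c) + an ≡ y + (1 + 2 * c) + an + (1 + 2 * m)
      left = solve-∀
      right : ∀ x m bn → x + bn + (1 + 2 * m) ≡ x + 1 * (1 + 2 * m) + bn
      right = solve-∀
    orient : toℕ x + (1 + 2 * c) + a * n ≡ toℕ y + b * n ⊎ toℕ y + (1 + 2 * c) + a * n ≡ toℕ x + b * n →
      ∃₂ λ u v → Sums 1 (toℕ x) (toℕ y) u v
    orient (inj₁ eq) = e , 1 + m + c , total e c m e+c , even-e , even-e′ , b , a , up (toℕ x) (toℕ y) m e+c eq
    orient (inj₂ eq) = 1 + m + c , e , trans (+-comm (1 + m + c) e) (total e c m e+c) , even-e′ , even-e , a , b , down (toℕ x) (toℕ y) eq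

  2h<n : 2 * h < n
  2h<n = <-trans 2h<m (≤-<-trans (≤-trans (m≤m+n m (m + 0)) (n≤1+n _)) M<n)

  -- The multiple `2 * (h − U)` of `n` is below `n`, so `U = h`; but `h` is odd.
  pinned : ∀ {U a b} → 2 * U + a * n ≡ 2 * h + b * n → ¬ (U ≤ h × (U ≤ h → 2 ∣ U))
  pinned {U} {a} {b} eq (U≤h , even) with slack U≤h
  ... | d , h≡U+d = 2∤h (subst (2 ∣_) (sym (trans h≡U+d (trans (cong (U +_) d≡0) (+-identityʳ U)))) (even U≤h))
    where
    rearrange : ∀ U d bn → 2 * (U + d) + bn ≡ 2 * U + (bn + 2 * d)
    rearrange = solve-∀
    split : a * n ≡ b * n + 2 * d
    split = +-cancelˡ-≡ (2 * U) _ _ (trans eq (trans (cong (λ h → 2 * h + b * n) h≡U+d) (rearrange U d (b * n))))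
    2d<n : 2 * d < n
    2d<n = ≤-<-trans (*-monoʳ-≤ 2 (subst (d ≤_) (sym h≡U+d) (m≤n+m d U))) 2h<n
    d≡0 : d ≡ 0
    d≡0 = m+n≡0⇒m≡0 d (multiple<⇒0 (∣m+n∣m⇒∣n (subst (n ∣_) split (n∣m*n a)) (n∣m*n b)) 2d<n)

  -- With `U = h + 1 + i` and `V = h + 1 + j` the sum gives `i + j + 2 = n`. Then `2 * (i + 1)` is a
  -- multiple of `n` strictly between 0 and `2 * n`, so it equals the odd number `n`.
  ¬both-large : ∀ {U V a b} → U + V ≡ n + 2 * h → 2 * U + a * n ≡ 2 * h + b * n → ¬ (h < U × h < V)
  ¬both-large {a = a} {b} sum eq (h<U , h<V) with slack h<U | slack h<V
  ... | i , refl | j , refl = twice q refl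
    where
    rearrange : ∀ h i j → suc h + i + (suc h + j) ≡ 2 + (i + j) + 2 * h
    rearrange = solve-∀
    rearrange′ : ∀ h i an → 2 * h + (an + 2 * suc i) ≡ 2 * (suc h + i) + an
    rearrange′ = solve-∀
    n≡ : 2 + (i + j) ≡ n
    n≡ = +-cancelʳ-≡ (2 * h) _ _ (trans (sym (rearrange h i j)) sum)
    n∣ : n ∣ 2 * suc i
    n∣ = ∣m+n∣m⇒∣n (subst (n ∣_) (sym (+-cancelˡ-≡ (2 * h) _ _ (trans (rearrange′ h i (a * n)) eq))) (n∣m*n b)) (n∣m*n a)
    q : ℕ
    q = quotient n∣
    twice : ∀ k → ¬ q ≡ k
    twice k q≡k = multiples k (trans (_∣_.equality n∣) (cong (_* n) q≡k))
      where
      multiples : ∀ k → ¬ 2 * suc i ≡ k * n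
      multiples zero ()
      multiples (suc zero) eq = even≢odd (suc i) ν (trans eq (*-identityˡ n))
      multiples (suc (suc k)) eq = <⇒≱ (*-monoʳ-< 2 (subst (suc i <_) n≡ (s≤s (s≤s (m≤m+n i j)))))
        (subst (2 * n ≤_) (sym eq) (*-monoˡ-≤ n (s≤s (s≤s (z≤n {k})))))

  ¬closed-sums : ∀ {w U V} → ¬ Sums (3 + 2 * p) w w U V
  ¬closed-sums {w} {U} {V} (UV , evenU , evenV , a , b , eq) =
    [ (λ U≤h → pinned {U} {a} {1 + b} eqU (U≤h , evenU))
    , (λ h<U → [ (λ V≤h → pinned {V} {1 + b} {2 + a} eqV (V≤h , evenV))
               , (λ h<V → ¬both-large {U} {V} {a} {1 + b} sum≡ eqU (h<U , h<V)) ]′ (≤-<-connex V h)) ]′ (≤-<-connex U h)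
    where
    sum≡ : U + V ≡ n + 2 * h
    sum≡ = trans UV (sym order)
    eqU : 2 * U + a * n ≡ 2 * h + (1 + b) * n
    eqU = closing-sum w n h a b {U} (trans eq (cong (λ t → w + t + b * n) (sym order)))
    eqV : 2 * V + (1 + b) * n ≡ 2 * h + (2 + a) * n
    eqV = complementary-sum n h a b {U} {V} sum≡ eqU

  free : ¬ HasCycle (3 + 2 * p) (adj graph)
  free cycle = ¬closed-sums (proj₂ (proj₂ sums))
    where
    w : ℕ
    w = toℕ (proj₁ cycle zero)
    advance : ∀ s x y → adj graph x y ≡ true → ∃₂ (Sums s w (toℕ x)) → ∃₂ (Sums (suc s) w (toℕ y))
    advance s x y adjacent (U , V , sums) with sums-edge x y adjacent
    ... | u , v , sums′ = U + u , V + v , sums-trans {s} {1} {w} {toℕ x} {toℕ y} sums sums′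
    sums : ∃₂ (Sums (3 + 2 * p) w w)
    sums = closed-walk-induction (adj graph) (λ s x → ∃₂ (Sums s w (toℕ x))) advance (2 + 2 * p) cycle
      (0 , 0 , refl , (λ _ → 2 ∣0) , (λ _ → 2 ∣0) , 0 , 0 , refl)

  -- Saturation: even distances as sums of good distances

  good-top : ∀ {c} → c + h < m → Good c
  good-top {c} c+h<m with slack c+h<m
  ... | d , eq = good {c} {suc h + d} (trans (rearrange c h d) (sym eq)) (inj₁ (s≤s (m≤m+n h d)))
    where
    rearrange : ∀ c h d → c + (suc h + d) ≡ suc (c + h) + d
    rearrange = solve-∀

  good-m : Good m
  good-m = good (+-identityʳ m) (inj₂ (2 ∣0))

  prepend : ∀ {s b c r} → (∀ {d} → d ≤ b → Climb s d) → Good c → c ≤ r → r ≤ c + b → Climb (suc s) r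
  prepend {c = c} climb g c≤r r≤c+b with slack c≤r
  ... | d , refl = step g (climb (+-cancelˡ-≤ c d _ r≤c+b))

  -- Greedy: 0 while the rest can absorb it, otherwise one of the large steps l and m, whichever does not overshoot.
  climb-low : ∀ l → suc (l + h) ≡ m → ∀ s {r} → r ≤ s * m + l → Climb (suc s) r
  climb-low l l+h<m zero {r} r≤l = subst (Climb 1) (+-identityʳ r)
    (step (good-top (≤-<-trans (+-monoˡ-≤ h r≤l) (≤-reflexive l+h<m))) stop)
  climb-low l l+h<m (suc s) {r} r≤ with r ≤? s * m + l
  ... | yes r≤′ = step (good-top h<m) (climb-low l l+h<m s r≤′)
  ... | no r≰ with r ≤? s * m + l + l
  ...   | yes r≤l = prepend (climb-low l l+h<m s) (good-top (≤-reflexive l+h<m))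
    (≤-trans (m≤n+m l (s * m)) (<⇒≤ (≰⇒> r≰))) (subst (r ≤_) (+-comm (s * m + l) l) r≤l)
  ...   | no r≰l = prepend (climb-low l l+h<m s) good-m m≤r (subst (r ≤_) (+-assoc m (s * m) l) r≤)
    where
    h≤l : h ≤ l
    h≤l = linear h l 0 (subst (2 * h <_) (sym l+h<m) 2h<m) (eq h l)
      where
      eq : ∀ h l → h + suc (l + h) + 0 ≡ l + suc (2 * h)
      eq = solve-∀
    -- Both smaller choices failed, so `r` is above `s * m + l + l`; with `h ≤ l` this reaches
    -- `l + h + 1 = m`.
    m≤r : m ≤ r
    m≤r = begin
      m                ≡⟨ l+h<m ⟨
      suc (l + h)      ≤⟨ s≤s (+-mono-≤ (m≤n+m l (s * m)) h≤l) ⟩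
      suc (s * m + l + l) ≤⟨ ≰⇒> r≰l ⟩
      r                ∎
      where open ≤-Reasoning

  climb-high : ∀ s {g} → Good g → Climb (suc s) (s * m + g)
  climb-high zero {g} good-g = subst (Climb 1) (+-identityʳ g) (step good-g stop)
  climb-high (suc s) {g} good-g = subst (Climb (suc (suc s))) (sym (+-assoc m (s * m) g)) (step good-m (climb-high s good-g))

  -- A code `c` is bad in two ways. Above `m`, it leaves a target low enough for `climb-low`.
  -- Otherwise its defect `e` is odd and at most `h`, and the target is the one reached by
  -- `climb-high` with last code `m − (h − e)`.
  climb : ∀ r c → (3 + 2 * p) * m ≡ r + c + h → ¬ Good c → Climb (2 + 2 * p) r
  climb r c eq ¬good-c with c ≤? m
  ... | no c≰m with slack h<m
  ...   | l , m≡ = climb-low l (trans (cong suc (+-comm l h)) (sym m≡)) (1 + 2 * p) (low-bound p m≡ eq (≰⇒> c≰m))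
  climb r c eq ¬good-c | yes c≤m with slack c≤m
  ... | e , m≡c+e with slack {e} {h} (≮⇒≥ λ h<e → ¬good-c (good (sym m≡c+e) (inj₁ h<e)))
  ...   | w , h≡e+w with slack {w} {m} (≤-trans (subst (w ≤_) (sym h≡e+w) (m≤n+m w e)) (<⇒≤ h<m))
  ...     | g , m≡w+g = subst (Climb (2 + 2 * p)) (high-sum p m≡c+e h≡e+w m≡w+g eq)
      (climb-high (1 + 2 * p) (good {g} {w} (trans (+-comm g w) (sym m≡w+g)) (inj₂ 2∣w)))
    where
    double : ∀ e w → e + (e + w) ≡ 2 * e + w
    double = solve-∀
    -- Both `e` and `h` are odd, so `w = h − e` is even and the last code is good.
    2∣w : 2 ∣ w
    2∣w = ∣m+n∣m⇒∣n (subst (2 ∣_) (trans (cong (e +_) h≡e+w) (double e w))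
      (2∤-sum (λ 2∣e → ¬good-c (good (sym m≡c+e) (inj₂ 2∣e))) 2∤h)) (m∣m*n e)

  -- The comparison of `e` with `p` is that of the distance with the path length `2 + 2 * p`. A
  -- shorter distance is followed by unit steps; any other is climbed, with `c` bad because the
  -- complement `1 + 2 * c` is not joined.
  completes-even : ∀ e → 2 * suc e < n → ¬ Joined (2 * suc e) → Completes (2 + 2 * p) (2 * suc e)
  completes-even e 2e<n ¬joined with e <? p
  ... | yes e<p = subst (Completes (2 + 2 * p)) (sym (*-suc 2 e)) (short-completes (good-top h<m) e p (good-top (linear _ m h (+-mono-≤ m-large e<p) (top h m e p))))
    where
    top : ∀ h m e p → suc (1 + e + p + h) + (m + p) + h ≡ m + (suc (2 * h + 2 * p) + suc e)
    top = solve-∀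
  ... | no e≮p with slack (≮⇒≥ e≮p) | slack {suc e} {ν} (<⇒≤pred (*-cancelˡ-< 2 (suc e) (suc ν) (<-trans 2e<n (subst (n <_) (sym (*-suc 2 ν)) (n<1+n n)))))
  ...   | r , refl | c , eq = subst (Completes (2 + 2 * p)) (length≡ p r)
      (climb-completes (climb r c (half-order p {m = m} eq order) ¬good-c) (subst (_< n) (sym (length≡ p r)) 2e<n))
    where
    length≡ : ∀ p r → 2 + 2 * p + 2 * r ≡ 2 * suc (p + r)
    length≡ = solve-∀
    total : ∀ p r c → 1 + 2 * c + 2 * suc (p + r) ≡ 1 + 2 * (suc (p + r) + c)
    total = solve-∀
    ¬good-c : ¬ Good c
    ¬good-c g = ¬joined (joined-complement (trans (total p r c) (cong (λ ν → 1 + 2 * ν) (sym eq))) (good⇒joined g))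

  complete : ∀ δ → 0 < δ → δ < n → ¬ Joined δ → ∃ λ t → (t ≡ δ ⊎ t + δ ≡ n) × Completes (2 + 2 * p) t
  complete δ 0<δ δ<n ¬joined with halve δ
  ... | inj₁ (suc d , refl) = _ , inj₁ refl , completes-even d δ<n ¬joined
  -- As `n` is odd, the complement of an odd `δ` is even, and it is not joined either.
  ... | inj₂ (c , refl) with slack (*-cancelˡ-< 2 c ν (≤-pred δ<n))
  ...   | e , refl = 2 * suc e , inj₂ (total c e) , completes-even e (s≤s (*-monoʳ-≤ 2 {suc e} {suc c + e} (s≤s (m≤n+m e c)))) (λ joined → ¬joined (joined-complement (total c e) joined))
    where
    total : ∀ c e → 2 * suc e + (1 + 2 * c) ≡ 1 + 2 * (suc c + e)
    total = solve-∀

  saturated : Saturated (3 + 2 * p) graph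
  saturated = free , saturating (2 + 2 * p) complete

-- Choice of parameters for odd order

odd-order : ∀ ν p → (3 + 2 * p) * (24 + 12 * p) ≤ ν →
  Σ (Graph (1 + 2 * ν)) λ G → Regular G × Saturated (3 + 2 * p) G
odd-order ν p large with slack {ν % (3 + 2 * p)} {2 + 2 * p} (<⇒≤pred (m%n<n ν (3 + 2 * p)))
... | τ , 2+2p≡ = choose
  where
  open ≤-Reasoning
  k q σ h : ℕ
  k = 3 + 2 * p
  q = ν / k
  σ = ν % k
  -- The solution of `n + 2 * h = k * (1 + 2 * m)` for `m = 1 + q`, where `τ = k − 1 − σ`.
  h = 2 + p + τ
  -- Since `τ` is at most `2 + 2 * p`, the sum `2 * (h + k) + 2 * p` is at most `14 + 12 * p`, so
  -- this `q` is large enough for both choices of `m`.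
  24+12p≤q : 24 + 12 * p ≤ q
  24+12p≤q = <⇒≤pred (*-cancelˡ-< k (24 + 12 * p) (suc q) (begin-strict
    k * (24 + 12 * p)  ≤⟨ large ⟩
    ν                  ≡⟨ m≡m%n+[m/n]*n ν k ⟩
    σ + q * k          <⟨ +-monoˡ-< (q * k) (m%n<n ν k) ⟩
    suc q * k          ≡⟨ *-comm (suc q) k ⟩
    k * suc q          ∎))
  τ≤ : 2 * τ ≤ 2 * (2 + 2 * p)
  τ≤ = *-monoʳ-≤ 2 (subst (τ ≤_) (sym 2+2p≡) (m≤n+m τ σ))
  order : ∀ ν p σ q τ → ν ≡ σ + q * (3 + 2 * p) → 2 + 2 * p ≡ σ + τ →
    1 + 2 * ν + 2 * (2 + p + τ) ≡ (3 + 2 * p) * (1 + 2 * (1 + q))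
  order ν p σ q τ refl 2+2p≡ = trans (collect p σ q τ) (trans (cong (λ t → 5 + 2 * p + 2 * t + 2 * q * (3 + 2 * p)) (sym 2+2p≡)) (expand p q))
    where
    collect : ∀ p σ q τ → 1 + 2 * (σ + q * (3 + 2 * p)) + 2 * (2 + p + τ) ≡ 5 + 2 * p + 2 * (σ + τ) + 2 * q * (3 + 2 * p)
    collect = solve-∀
    expand : ∀ p q → 5 + 2 * p + 2 * (2 + 2 * p) + 2 * q * (3 + 2 * p) ≡ (3 + 2 * p) * (1 + 2 * (1 + q))
    expand = solve-∀
  order₁ : 1 + 2 * ν + 2 * h ≡ k * (1 + 2 * (1 + q))
  order₁ = order ν p σ q τ (m≡m%n+[m/n]*n ν k) 2+2p≡
  order₂ : 1 + 2 * ν + 2 * (h + k) ≡ k * (1 + 2 * (2 + q))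
  order₂ = trans (split (1 + 2 * ν) h k) (trans (cong (_+ 2 * k) order₁) (join k q))
    where
    split : ∀ n h k → n + 2 * (h + k) ≡ n + 2 * h + 2 * k
    split = solve-∀
    join : ∀ k q → k * (1 + 2 * (1 + q)) + 2 * k ≡ k * (1 + 2 * (2 + q))
    join = solve-∀
  large₁ : 2 * h + 2 * p < 1 + q
  large₁ = linear _ _ (16 + 4 * p) (+-mono-≤ τ≤ 24+12p≤q) (eq p τ q)
    where
    eq : ∀ p τ q → suc (2 * (2 + p + τ) + 2 * p) + (2 * (2 + 2 * p) + q) + (16 + 4 * p) ≡ 1 + q + (2 * τ + (24 + 12 * p))
    eq = solve-∀
  large₂ : 2 * (h + k) + 2 * p < 2 + q
  large₂ = linear _ _ 11 (+-mono-≤ τ≤ 24+12p≤q) (eq p τ q)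
    where
    eq : ∀ p τ q → suc (2 * (2 + p + τ + (3 + 2 * p)) + 2 * p) + (2 * (2 + 2 * p) + q) + 11 ≡ 2 + q + (2 * τ + (24 + 12 * p))
    eq = solve-∀
  2∤k : ¬ 2 ∣ k
  2∤k = 2∤1+2* (1 + p) ∘ subst (2 ∣_) (cong suc (sym (*-suc 2 p)))
  -- Both (q + 1, h) and (q + 2, h + k) solve n + 2h = (ℓ + 1)(1 + 2m); as k is odd, one of h and h + k is odd.
  choose : Σ (Graph (1 + 2 * ν)) λ G → Regular G × Saturated (3 + 2 * p) G
  choose with 2 ∣? h
  ... | no 2∤h = graph , regular , saturated
    where open OddOrder ν p (1 + q) h order₁ 2∤h large₁
  ... | yes 2∣h = graph , regular , saturated
    where open OddOrder ν p (2 + q) (h + k) order₂ (λ 2∣h+k → 2∤k (∣m+n∣m⇒∣n 2∣h+k 2∣h)) large₂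

-- Combining both parities of the order

-- With `ℓ = 2 + 2 * p`, the threshold is `12 * (ℓ + 1) * (ℓ + 2)`, the quadratic bound in factored
-- form.
regular-saturated : ∀ p n → 2 * ((3 + 2 * p) * (24 + 12 * p)) < n →
  Σ (Graph n) λ G → Regular G × Saturated (3 + 2 * p) G
regular-saturated p n large with halve n
... | inj₁ (suc ν , refl) = even-order ν p (≤-trans (n≤1+n (2 + 2 * p)) (≤-trans (m≤m*n (3 + 2 * p) (24 + 12 * p))
  (<⇒≤ (*-cancelˡ-< 2 _ (suc ν) large))))
... | inj₂ (ν , refl) = odd-order ν p (*-cancelˡ-≤ 2 (≤-pred large))

theorem1p2 : (ℓ : ℕ) → 4 ≤ ℓ → 2 ∣ ℓ → (n : ℕ) → 12 * (ℓ * ℓ) + 36 * ℓ + 24 < n →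
    Σ (Graph n) λ G → Regular G × Saturated (ℓ + 1) G
theorem1p2 _ () (divides-refl zero)
theorem1p2 _ _ (divides-refl (suc p)) n large =
  subst (λ k → Σ (Graph n) λ G → Regular G × Saturated k G) (length≡ p) (regular-saturated p n (subst (_< n) (bound p) large))
  where
  length≡ : ∀ p → 3 + 2 * p ≡ suc p * 2 + 1
  length≡ = solve-∀
  bound : ∀ p → 12 * (suc p * 2 * (suc p * 2)) + 36 * (suc p * 2) + 24 ≡ 2 * ((3 + 2 * p) * (24 + 12 * p))
  bound = solve-∀
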